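{- Let $\alpha\in(0,1/2)$. Any one-dimensional $\alpha$-approximate range median data structure for sequences of length $n$ requires $\Omega(n)$ bits of space in the worst case.
   Context: Let $c_1,\dots,c_n$ be a sequence of elements from a totally ordered set; write $c_{a..b}$ for $c_a,\dots,c_b$. The $i$th smallest element in $c_{a..b}$ (counted with multiplicity) is said to have rank $i$ in $c_{a..b}$. For $\alpha\in(0,1/2)$, an $\alpha$-approximate range median query is given indices $1\le a\le b\le n$ and asks for the position (an index in $[a,b]$) of an element whose rank in $c_{a..b}$ is between $\lceil s/2\rceil-\alpha s$ and $\lceil s/2\rceil+\alpha s$, where $s=b-a+1$. A one-dimensional $\alpha$-approximate range median data structure is a map assigning to each sequence of length $n$ a bit string (its encoding), together with a query algorithm which, given only this bit string and a pair $(a,b)$ (and without access to the original sequence), correctly answers every $\alpha$-approximate range median query. Its space is the maximum length in bits of the encoding over all sequences of length $n$. The constant hidden in $\Omega(\cdot)$ is absolute. -}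

module Defs where

open import Level using (_⊔_)
open import Data.Bool.Base using (Bool)
open import Data.Fin.Base as Fin using (Fin; toℕ)
open import Data.Integer.Base using (+_)
open import Data.List.Base as List using (List; length; take; drop)
open import Data.List.Relation.Binary.Permutation.Propositional using (_↭_)
import Data.List.Relation.Unary.Sorted.TotalOrder as Sorting
open import Data.Nat.Base as ℕ using (ℕ; suc; ⌈_/2⌉)
open import Data.Product.Base using (Σ; ∃; ∃-syntax; _×_; _,_)
open import Data.Rational.Base as ℚ using (ℚ; _/_; 1/_; Positive; 1ℚ)
import Data.Rational.Properties as ℚ
open import Algebra.Properties.Group ℚ.+-0-group using (⁻¹-involutive)
open import Data.Sum.Base using (_⊎_; swap; inj₁; inj₂)
open import Data.Vec.Base as Vec using (Vec)
open import Relation.Binary.Bundles using (TotalOrder)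
open import Relation.Binary.Definitions using (tri<; tri≈; tri>)
open import Relation.Binary.PropositionalEquality
  using (_≡_; refl; sym; trans; cong; subst)
open import Relation.Nullary.Negation using (¬_)

------------------------------------------------------------------------
-- Real numbers as two-sided Dedekind cuts

-- Lower q means q < x, and Upper q means x < q.
record ℝ : Set₁ where
  field
    Lower Upper     : ℚ → Set
    lower-inhabited : ∃ Lower
    upper-inhabited : ∃ Upper
    lower-open      : ∀ {q} → Lower q → ∃[ r ] q ℚ.< r × Lower r
    upper-open      : ∀ {q} → Upper q → ∃[ r ] r ℚ.< q × Upper r
    lower-closed    : ∀ {q r} → q ℚ.< r → Lower r → Lower q
    upper-closed    : ∀ {q r} → r ℚ.< q → Upper r → Upper q
    disjoint        : ∀ {q} → ¬ (Lower q × Upper q)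
    located         : ∀ {q r} → q ℚ.< r → Lower q ⊎ Upper r

open ℝ

infix 4 _<ᵣ_ _≤ᵣ_

_<ᵣ_ : ℝ → ℝ → Set
x <ᵣ y = ∃[ q ] Upper x q × Lower y q

_≤ᵣ_ : ℝ → ℝ → Set
x ≤ᵣ y = ∀ q → Lower x q → Lower y q

fromℚ : ℚ → ℝ
fromℚ p .Lower q = q ℚ.< p
fromℚ p .Upper q = p ℚ.< q
fromℚ p .lower-inhabited = p ℚ.- 1ℚ ,
  subst (p ℚ.- 1ℚ ℚ.<_) (ℚ.+-identityʳ p)
    (ℚ.+-monoʳ-< p (ℚ.negative⁻¹ (ℚ.- 1ℚ)))
fromℚ p .upper-inhabited = p ℚ.+ 1ℚ ,
  subst (ℚ._< p ℚ.+ 1ℚ) (ℚ.+-identityʳ p)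
    (ℚ.+-monoʳ-< p (ℚ.positive⁻¹ 1ℚ))
fromℚ p .lower-open q<p = ℚ.<-dense q<p
fromℚ p .upper-open p<q with r , p<r , r<q ← ℚ.<-dense p<q = r , r<q , p<r
fromℚ p .lower-closed = ℚ.<-trans
fromℚ p .upper-closed r<q p<r = ℚ.<-trans p<r r<q
fromℚ p .disjoint (q<p , p<q) = ℚ.<-asym q<p p<q
fromℚ p .located {q} q<r with ℚ.<-cmp q p
... | tri< q<p _ _    = inj₁ q<p
... | tri≈ _ refl _   = inj₂ q<r
... | tri> _ _ p<q    = inj₂ (ℚ.<-trans p<q q<r)

fromℕ : ℕ → ℚ
fromℕ n = + n / 1

negᵣ : ℝ → ℝ
negᵣ x .Lower q = Upper x (ℚ.- q)
negᵣ x .Upper q = Lower x (ℚ.- q)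
negᵣ x .lower-inhabited with r , u ← upper-inhabited x =
  ℚ.- r , subst (Upper x) (sym (⁻¹-involutive r)) u
negᵣ x .upper-inhabited with r , l ← lower-inhabited x =
  ℚ.- r , subst (Lower x) (sym (⁻¹-involutive r)) l
negᵣ x .lower-open {q} u with r , r<-q , u′ ← upper-open x u =
  ℚ.- r
  , subst (ℚ._< ℚ.- r) (⁻¹-involutive q) (ℚ.neg-antimono-< r<-q)
  , subst (Upper x) (sym (⁻¹-involutive r)) u′
negᵣ x .upper-open {q} l with r , -q<r , l′ ← lower-open x l =
  ℚ.- r
  , subst (ℚ.- r ℚ.<_) (⁻¹-involutive q) (ℚ.neg-antimono-< -q<r)
  , subst (Lower x) (sym (⁻¹-involutive r)) l′
negᵣ x .lower-closed q<r = upper-closed x (ℚ.neg-antimono-< q<r)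
negᵣ x .upper-closed r<q = lower-closed x (ℚ.neg-antimono-< r<q)
negᵣ x .disjoint (u , l) = disjoint x (l , u)
negᵣ x .located q<r = swap (located x (ℚ.neg-antimono-< q<r))

-- The image of x under an increasing bijection g of ℚ with inverse f.
image : (g f : ℚ → ℚ) →
        (∀ {q r} → q ℚ.< r → g q ℚ.< g r) →
        (∀ {q r} → q ℚ.< r → f q ℚ.< f r) →
        (∀ q → g (f q) ≡ q) → (∀ q → f (g q) ≡ q) →
        ℝ → ℝ
image g f g-mono f-mono gf fg x = λ where
  .Lower q → Lower x (f q)
  .Upper q → Upper x (f q)
  .lower-inhabited → let r , l = lower-inhabited x in
    g r , subst (Lower x) (sym (fg r)) l
  .upper-inhabited → let r , u = upper-inhabited x in
    g r , subst (Upper x) (sym (fg r)) u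
  .lower-open {q} l → let r , fq<r , l′ = lower-open x l in
    g r , subst (ℚ._< g r) (gf q) (g-mono fq<r) , subst (Lower x) (sym (fg r)) l′
  .upper-open {q} u → let r , r<fq , u′ = upper-open x u in
    g r , subst (g r ℚ.<_) (gf q) (g-mono r<fq) , subst (Upper x) (sym (fg r)) u′
  .lower-closed q<r → lower-closed x (f-mono q<r)
  .upper-closed r<q → upper-closed x (f-mono r<q)
  .disjoint → disjoint x
  .located q<r → located x (f-mono q<r)

infixr 6 _+ᵣ_
infixr 7 _*ᵣ_

-- Only sums and products with a rational left operand are needed.
_+ᵣ_ : ℚ → ℝ → ℝ
p +ᵣ x = image (p ℚ.+_) (ℚ.- p ℚ.+_)
  (ℚ.+-monoʳ-< p) (ℚ.+-monoʳ-< (ℚ.- p))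
  (λ q → trans (sym (ℚ.+-assoc p (ℚ.- p) q))
           (trans (cong (ℚ._+ q) (ℚ.+-inverseʳ p)) (ℚ.+-identityˡ q)))
  (λ q → trans (sym (ℚ.+-assoc (ℚ.- p) p q))
           (trans (cong (ℚ._+ q) (ℚ.+-inverseˡ p)) (ℚ.+-identityˡ q)))
  x

_*ᵣ_ : (p : ℚ) .{{_ : Positive p}} → ℝ → ℝ
p *ᵣ x = image (p ℚ.*_) (1/p ℚ.*_)
  (ℚ.*-monoʳ-<-pos p) (ℚ.*-monoʳ-<-pos 1/p {{ℚ.1/pos⇒pos p}})
  (λ q → trans (sym (ℚ.*-assoc p 1/p q))
           (trans (cong (ℚ._* q) (ℚ.*-inverseʳ p)) (ℚ.*-identityˡ q)))
  (λ q → trans (sym (ℚ.*-assoc 1/p p q))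
           (trans (cong (ℚ._* q) (ℚ.*-inverseˡ p)) (ℚ.*-identityˡ q)))
  x
  where
  instance _ = ℚ.pos⇒nonZero p
  1/p = 1/ p

instance
  fromℕ-pos : ∀ {n} .{{_ : ℕ.NonZero n}} → Positive (fromℕ n)
  fromℕ-pos {n} = ℚ.normalize-pos n 1

------------------------------------------------------------------------
-- Approximate range medians

-- ⌈s/2⌉ - αs ≤ r ≤ ⌈s/2⌉ + αs
ApproxMedianRank : ℝ → (s : ℕ) .{{_ : ℕ.NonZero s}} → ℕ → Set
ApproxMedianRank α s r =
    (fromℕ ⌈ s /2⌉ +ᵣ negᵣ (fromℕ s *ᵣ α) ≤ᵣ fromℚ (fromℕ r))
  × (fromℚ (fromℕ r) ≤ᵣ fromℕ ⌈ s /2⌉ +ᵣ fromℕ s *ᵣ α)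

-- Positions are counted from 0; ranks are counted from 1.

rangeSize : ∀ {n} → Fin n → Fin n → ℕ
rangeSize a b = suc (toℕ b ℕ.∸ toℕ a)

range : ∀ {ℓ n} {A : Set ℓ} → Vec A n → Fin n → Fin n → List A
range c a b = take (rangeSize a b) (drop (toℕ a) (Vec.toList c))

module _ {a ℓ₁ ℓ₂} (O : TotalOrder a ℓ₁ ℓ₂) where
  open TotalOrder O using (Carrier; _≈_)
  open Sorting O using (Sorted)

  -- v is the r-th entry of a nondecreasing rearrangement of xs; a value
  -- that occurs several times has several ranks.
  HasRank : List Carrier → Carrier → ℕ → Set (a ⊔ ℓ₁ ⊔ ℓ₂)
  HasRank xs v r = ∃[ ys ] ys ↭ xs × Sorted ys ×
    Σ (Fin (length ys)) λ i → suc (toℕ i) ≡ r × List.lookup ys i ≈ v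

  IsApproxMedian : ∀ {n} → ℝ → Vec Carrier n → (i j p : Fin n) →
                   Set (a ⊔ ℓ₁ ⊔ ℓ₂)
  IsApproxMedian α c i j p = i Fin.≤ p × p Fin.≤ j ×
    ∃[ r ] HasRank (range c i j) (Vec.lookup c p) r
         × ApproxMedianRank α (rangeSize i j) r

  record ApproxRangeMedian (α : ℝ) (n : ℕ) : Set (a ⊔ ℓ₁ ⊔ ℓ₂) where
    field
      encode  : Vec Carrier n → List Bool
      query   : List Bool → Fin n → Fin n → Fin n
      correct : ∀ c i j → i Fin.≤ j →
                IsApproxMedian α c i j (query (encode c) i j)

  -- The maximum encoding length is at least k. Stating this through a
  -- witness also covers encodings of unbounded length.
  SpaceAtLeast : ∀ {α n} → ApproxRangeMedian α n → ℚ → Set a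
  SpaceAtLeast D k = ∃[ c ] k ℚ.≤ fromℕ (length (encode c))
    where open ApproxRangeMedian D

-- Since 2α < 1, a query on two adjacent positions must return the position of
-- the minimum.  Cutting the sequence into ⌊n/2⌋ blocks, each holding two
-- distinct values in one of two orders, gives 2^⌊n/2⌋ sequences that are told
-- apart by these queries, hence have distinct encodings.

module Submission where

open import Defs
open import Level using (Level)
open import Data.Nat.Base as ℕ using (ℕ)
open import Data.Product.Base using (_×_; ∃-syntax)
open import Data.Rational.Base as ℚ using (ℚ; 0ℚ; ½)
open import Relation.Binary.Bundles using (TotalOrder)
open import Relation.Nullary.Negation using (¬_)

open import Data.Bool.Base using (Bool; true; false)
open import Data.Empty using (⊥-elim)
open import Data.Fin.Base as Fin
  using (Fin; toℕ; fromℕ<; combine; finToFun; funToFin)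
open import Data.Fin.Patterns using (0F; 1F)
import Data.Fin.Properties as Fin
open import Data.Integer.Base as ℤ using (+_)
import Data.Integer.Properties as ℤ
open import Data.List.Base using (List; []; _∷_; length; take; drop)
open import Data.List.Relation.Binary.Permutation.Propositional.Properties
  using (All-resp-↭)
open import Data.List.Relation.Unary.All as All using (All; []; _∷_)
open import Data.List.Relation.Unary.Linked.Properties using (Linked⇒All)
open import Data.Nat.Base using (suc; ⌊_/2⌋; _^_; z≤n; s≤s)
open import Data.Nat.Binary.Base as ℕᵇ using (ℕᵇ; 2[1+_]; 1+[2_])
import Data.Nat.Binary.Properties as ℕᵇ
import Data.Nat.Properties as ℕ
open import Data.Product.Base using (_,_)
import Data.Rational.Properties as ℚ
open import Data.Rational.Solver using (module +-*-Solver)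
open import Data.Rational.Unnormalised.Base as ℚᵘ using (mkℚᵘ)
import Data.Rational.Unnormalised.Properties as ℚᵘ
open import Data.Sum.Base using (inj₁; inj₂)
open import Data.Vec.Base as Vec using (Vec; []; _∷_; lookup)
open import Function.Base using (_∘_; case_of_)
open import Function.Definitions using (Injective)
open import Relation.Binary.PropositionalEquality
  using (_≡_; _≗_; refl; sym; trans; cong; cong₂; subst; subst₂)
open import Relation.Nullary.Decidable using (yes; no)

-- Rational arithmetic and the rank bound for two elements.

toℚᵘ-fromℕ : ∀ n → ℚ.toℚᵘ (fromℕ n) ℚᵘ.≃ mkℚᵘ (+ n) 0
toℚᵘ-fromℕ n = ℚ.toℚᵘ-fromℚᵘ (mkℚᵘ (+ n) 0)

fromℕ-mono-≤ : ∀ {m n} → m ℕ.≤ n → fromℕ m ℚ.≤ fromℕ n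
fromℕ-mono-≤ {m} {n} m≤n = ℚ.toℚᵘ-cancel-≤ (begin
  ℚ.toℚᵘ (fromℕ m)  ≃⟨ toℚᵘ-fromℕ m ⟩
  mkℚᵘ (+ m) 0      ≤⟨ ℚᵘ.*≤* (ℤ.*-monoʳ-≤-nonNeg (+ 1) (ℤ.+≤+ m≤n)) ⟩
  mkℚᵘ (+ n) 0      ≃⟨ toℚᵘ-fromℕ n ⟨
  ℚ.toℚᵘ (fromℕ n)  ∎)
  where open ℚᵘ.≤-Reasoning

¼ : ℚ
¼ = + 1 ℚ./ 4

¼*fromℕ≤ : ∀ {m n} → m ℕ.≤ n ℕ.* 4 → ¼ ℚ.* fromℕ m ℚ.≤ fromℕ n
¼*fromℕ≤ {m} {n} m≤4n = ℚ.toℚᵘ-cancel-≤ (begin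
  ℚ.toℚᵘ (¼ ℚ.* fromℕ m)            ≃⟨ ℚ.toℚᵘ-homo-* ¼ (fromℕ m) ⟩
  ℚ.toℚᵘ ¼ ℚᵘ.* ℚ.toℚᵘ (fromℕ m)    ≃⟨ ℚᵘ.*-congˡ {ℚ.toℚᵘ ¼} (toℚᵘ-fromℕ m) ⟩
  ℚ.toℚᵘ ¼ ℚᵘ.* mkℚᵘ (+ m) 0        ≤⟨ ℚᵘ.*≤* lemma ⟩
  mkℚᵘ (+ n) 0                      ≃⟨ toℚᵘ-fromℕ n ⟨
  ℚ.toℚᵘ (fromℕ n)                  ∎)
  where
  open ℚᵘ.≤-Reasoning
  lemma : + 1 ℤ.* + m ℤ.* + 1 ℤ.≤ + n ℤ.* + 4
  lemma = subst₂ ℤ._≤_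
    (sym (trans (ℤ.*-identityʳ _) (ℤ.*-identityˡ (+ m))))
    (ℤ.pos-* n 4) (ℤ.+≤+ m≤4n)

-- The hypothesis `α < ½` supplies a rational `p` strictly between the two. If `r ≥ 2`, then
-- `1 + 2p < 2 ≤ r`, so the upper rank bound `r ≤ 1 + 2α` puts `p` in the lower cut of `α`, although
-- it already lies in the upper one.
approxMedianRank-2 : ∀ {α r} → α <ᵣ fromℚ ½ → ApproxMedianRank α 2 r → r ℕ.≤ 1
approxMedianRank-2 {α} {r} (p , α<p , p<½) (_ , r≤1+2α) = ℕ.≮⇒≥ λ 1<r →
  disjoint (subst Lower (half p) (lower 1<r) , α<p)
  where
  open ℝ α
  q : ℚ
  q = fromℕ 1 ℚ.+ fromℕ 2 ℚ.* p
  q<2 : q ℚ.< fromℕ 2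
  q<2 = ℚ.+-monoʳ-< (fromℕ 1) (ℚ.*-monoʳ-<-pos (fromℕ 2) p<½)
  -- Membership of `q` in the lower cut of `1 + 2α` computes to this form, with the inverse affine
  -- map applied to `q`; `half` simplifies the argument to `p`.
  lower : 1 ℕ.< r → Lower (½ ℚ.* (ℚ.- fromℕ 1 ℚ.+ q))
  lower 1<r = r≤1+2α q (ℚ.<-≤-trans q<2 (fromℕ-mono-≤ 1<r))
  half : ∀ p → ½ ℚ.* (ℚ.- fromℕ 1 ℚ.+ (fromℕ 1 ℚ.+ fromℕ 2 ℚ.* p)) ≡ p
  half = solve 1 (λ p →
    con ½ :* (con (ℚ.- fromℕ 1) :+ (con (fromℕ 1) :+ con (fromℕ 2) :* p)) := p) refl
    where open +-*-Solver

-- Counting bit strings.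

-- Reading a list as a bijective base-2 numeral keeps its length
-- recoverable, unlike ordinary binary notation.
fromBits : List Bool → ℕᵇ
fromBits []           = ℕᵇ.zero
fromBits (false ∷ bs) = 1+[2 fromBits bs ]
fromBits (true  ∷ bs) = 2[1+ fromBits bs ]

fromBits-injective : Injective _≡_ _≡_ fromBits
fromBits-injective {[]}         {[]}         _  = refl
fromBits-injective {[]}         {false ∷ _}  ()
fromBits-injective {[]}         {true ∷ _}   ()
fromBits-injective {false ∷ _}  {false ∷ _}  eq =
  cong (false ∷_) (fromBits-injective (ℕᵇ.1+[2_]-injective eq))
fromBits-injective {true ∷ _}   {true ∷ _}   eq =
  cong (true ∷_) (fromBits-injective (ℕᵇ.2[1+_]-injective eq))

-- Lists consisting of `true` only attain equality. The offset 2 makes the induction close, since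
-- `2 + 2(1 + n) = 2(2 + n)`.
fromBits-bound : ∀ bs → 2 ℕ.+ ℕᵇ.toℕ (fromBits bs) ℕ.≤ 2 ^ suc (length bs)
fromBits-bound []           = ℕ.≤-refl
fromBits-bound (true ∷ bs)  = begin
  2 ℕ.+ 2 ℕ.* suc n        ≡⟨ ℕ.*-suc 2 (suc n) ⟨
  2 ℕ.* (2 ℕ.+ n)          ≤⟨ ℕ.*-monoʳ-≤ 2 (fromBits-bound bs) ⟩
  2 ^ suc (suc (length bs)) ∎
  where
  open ℕ.≤-Reasoning
  n = ℕᵇ.toℕ (fromBits bs)
fromBits-bound (false ∷ bs) = begin
  2 ℕ.+ suc (2 ℕ.* n)      ≤⟨ ℕ.n≤1+n _ ⟩
  2 ℕ.+ (2 ℕ.+ 2 ℕ.* n)    ≡⟨ cong (2 ℕ.+_) (ℕ.*-suc 2 n) ⟨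
  2 ℕ.+ 2 ℕ.* suc n        ≡⟨ ℕ.*-suc 2 (suc n) ⟨
  2 ℕ.* (2 ℕ.+ n)          ≤⟨ ℕ.*-monoʳ-≤ 2 (fromBits-bound bs) ⟩
  2 ^ suc (suc (length bs)) ∎
  where
  open ℕ.≤-Reasoning
  n = ℕᵇ.toℕ (fromBits bs)

-- There are only `2^k - 1` lists shorter than `k`, so `2^k` distinct lists cannot all be that
-- short.
injective⇒long : ∀ k (f : Fin (2 ^ k) → List Bool) → Injective _≡_ _≡_ f →
                 ∃[ i ] k ℕ.≤ length (f i)
injective⇒long k f f-inj with Fin.any? (λ i → k ℕ.≤? length (f i))
... | yes long = long
... | no ¬long = ⊥-elim collision
  where
  code : Fin (2 ^ k) → ℕ
  code i = ℕᵇ.toℕ (fromBits (f i))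
  code< : ∀ i → code i ℕ.< ℕ.pred (2 ^ k)
  -- Of the 2 units of slack in `fromBits-bound`, one gives strictness and the other lowers `2^k` to
  -- its predecessor, which the pigeonhole needs.
  code< i = ℕ.pred-mono-≤ (ℕ.≤-trans (fromBits-bound (f i))
    (ℕ.^-monoʳ-≤ 2 (ℕ.≰⇒> λ k≤ → ¬long (i , k≤))))
  2^k≢0 = ℕ.m^n≢0 2 k
  collision =
    let i , j , i<j , eq = Fin.pigeonhole
          (ℕ.≤-reflexive (ℕ.suc-pred (2 ^ k) {{2^k≢0}})) (λ i → fromℕ< (code< i))
        fi≡fj = fromBits-injective
          (ℕᵇ.toℕ-injective (Fin.fromℕ<-injective _ _ (code< i) (code< j) eq))
    in Fin.<⇒≢ i<j (f-inj fi≡fj)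

funToFin-cong : ∀ {m n} {f g : Fin m → Fin n} → f ≗ g → funToFin f ≡ funToFin g
funToFin-cong {ℕ.zero} f≗g = refl
funToFin-cong {suc m}  f≗g = cong₂ combine (f≗g 0F) (funToFin-cong (f≗g ∘ Fin.suc))

-- Agreement is only pointwise, so `funToFin-cong` takes the place of function extensionality in the
-- round trip.
finToFun-injective : ∀ {m n} {i j : Fin (n ^ m)} →
                     finToFun {n} {m} i ≗ finToFun j → i ≡ j
finToFun-injective {m} {n} {i} {j} i≗j = trans (sym (Fin.funToFin-finToFin {m} {n} i))
  (trans (funToFin-cong i≗j) (Fin.funToFin-finToFin {m} {n} j))

-- Adjacent positions and blocks of two.

adjacent-∸ : ∀ {m n} → n ≡ suc m → n ℕ.∸ m ≡ 1
adjacent-∸ {m} refl = ℕ.m+n∸n≡m 1 m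

range-adjacent : ∀ {a n} {A : Set a} (c : Vec A n) {i j : Fin n} →
                 toℕ j ≡ suc (toℕ i) → range c i j ≡ lookup c i ∷ lookup c j ∷ []
range-adjacent {A = A} c {i} {j} j≡1+i = trans
  -- The truncated subtraction in `rangeSize` blocks `take`, so the size is rewritten to 2 before
  -- the recursion on `c`.
  (cong (λ s → take (suc s) (drop (toℕ i) (Vec.toList c))) (adjacent-∸ j≡1+i))
  (take-2 c j≡1+i)
  where
  take-2 : ∀ {n} (c : Vec A n) {i j : Fin n} → toℕ j ≡ suc (toℕ i) →
           take 2 (drop (toℕ i) (Vec.toList c)) ≡ lookup c i ∷ lookup c j ∷ []
  take-2 (_ ∷ _ ∷ _) {0F}        {1F}        _  = refl
  take-2 (_ ∷ c)     {Fin.suc i} {Fin.suc j} eq = take-2 c (ℕ.suc-injective eq)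

-- pos t b is the position of the entry with index b in the t-th block.
pos : ∀ {n} → Fin ⌊ n /2⌋ → Fin 2 → Fin n
pos {suc (suc n)} 0F          0F = 0F
pos {suc (suc n)} 0F          1F = 1F
pos {suc (suc n)} (Fin.suc t) b  = Fin.suc (Fin.suc (pos t b))

-- Blocks start at even positions, so parity reads off the index inside a block without knowing the
-- block.
parity : ∀ {n} → Fin n → Fin 2
parity 0F                    = 0F
parity 1F                    = 1F
parity (Fin.suc (Fin.suc i)) = parity i

parity-pos : ∀ {n} (t : Fin ⌊ n /2⌋) b → parity (pos {n} t b) ≡ b
parity-pos {suc (suc n)} 0F          0F = refl
parity-pos {suc (suc n)} 0F          1F = refl
parity-pos {suc (suc n)} (Fin.suc t) b  = parity-pos t b

pos-adjacent : ∀ {n} (t : Fin ⌊ n /2⌋) → toℕ (pos {n} t 1F) ≡ suc (toℕ (pos {n} t 0F))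
pos-adjacent {suc (suc n)} 0F          = refl
pos-adjacent {suc (suc n)} (Fin.suc t) = cong (2 ℕ.+_) (pos-adjacent t)

pos-surjective : ∀ {n} (t : Fin ⌊ n /2⌋) {p : Fin n} →
                 pos t 0F Fin.≤ p → p Fin.≤ pos t 1F → ∃[ b ] p ≡ pos t b
pos-surjective {suc (suc n)} 0F          {0F}                  _ _ = 0F , refl
pos-surjective {suc (suc n)} 0F          {1F}                  _ _ = 1F , refl
pos-surjective {suc (suc n)} 0F          {Fin.suc (Fin.suc p)} _ (s≤s ())
pos-surjective {suc (suc n)} (Fin.suc t) {Fin.suc (Fin.suc p)} (s≤s (s≤s l)) (s≤s (s≤s u))
  with b , eq ← pos-surjective t l u = b , cong (Fin.suc ∘ Fin.suc) eq

module _ {a} {A : Set a} (x y : A) where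

  entry : Fin 2 → Fin 2 → A
  entry 0F 0F = x
  entry 0F 1F = y
  entry 1F 0F = y
  entry 1F 1F = x

  -- Block t is x y or y x, with x at index w t.
  blocks : ∀ {n} → (Fin ⌊ n /2⌋ → Fin 2) → Vec A n
  blocks {0}           w = []
  -- An odd length leaves one last position outside every block; its value is arbitrary.
  blocks {1}           w = x ∷ []
  blocks {suc (suc n)} w = entry (w 0F) 0F ∷ entry (w 0F) 1F ∷ blocks (w ∘ Fin.suc)

  lookup-blocks : ∀ {n} (w : Fin ⌊ n /2⌋ → Fin 2) t b →
                  lookup (blocks {n} w) (pos t b) ≡ entry (w t) b
  lookup-blocks {suc (suc n)} w 0F          0F = refl
  lookup-blocks {suc (suc n)} w 0F          1F = refl
  lookup-blocks {suc (suc n)} w (Fin.suc t) b  = lookup-blocks (w ∘ Fin.suc) t b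

-- The factor 4 absorbs the rounding. The claim fails at `n = 1`, where there is no block; hence the
-- threshold 2. Going from `n` to `n + 2` adds 2 on the left and 4 on the right.
n≤⌊n/2⌋*4 : ∀ n → 2 ℕ.≤ n → n ℕ.≤ ⌊ n /2⌋ ℕ.* 4
n≤⌊n/2⌋*4 1 (s≤s ())
n≤⌊n/2⌋*4 2 _ = s≤s (s≤s z≤n)
n≤⌊n/2⌋*4 3 _ = s≤s (s≤s (s≤s z≤n))
n≤⌊n/2⌋*4 (suc (suc n@(suc (suc _)))) _ = ℕ.≤-trans
  (ℕ.m≤n+m (2 ℕ.+ n) 2) (ℕ.+-monoʳ-≤ 4 (n≤⌊n/2⌋*4 n (s≤s (s≤s z≤n))))

-- Recovering the block orders from query answers.

module _ {a ℓ₁ ℓ₂} (O : TotalOrder a ℓ₁ ℓ₂) where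
  open TotalOrder O using (Carrier; _≈_; _≤_; total; antisym; module Eq)
    renaming (refl to ≤-refl; trans to ≤-trans; reflexive to ≤-reflexive)

  -- Ranks start at 1, so `v` is equivalent to the head of a sorted rearrangement. The head is below
  -- every entry, and the permutation carries this back to `xs`.
  hasRank-1 : ∀ {xs v r} → r ℕ.≤ 1 → HasRank O xs v r → All (v ≤_) xs
  hasRank-1 _ (_ ∷ _ , perm , sorted , 0F , _ , y≈v) = All-resp-↭ perm
    (All.map (≤-trans (≤-reflexive (Eq.sym y≈v))) (Linked⇒All ≤-trans ≤-refl sorted))
  hasRank-1 (s≤s ()) (_ ∷ _ , _ , _ , Fin.suc _ , refl , _)

  approxMedian-adjacent : ∀ {α n} {c : Vec Carrier n} {i j p} → α <ᵣ fromℚ ½ →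
    toℕ j ≡ suc (toℕ i) → IsApproxMedian O α c i j p →
    All (lookup c p ≤_) (lookup c i ∷ lookup c j ∷ [])
  approxMedian-adjacent {α} {c = c} {i} {j} α<½ j≡1+i (_ , _ , r , rank , median) =
    subst (All _) (range-adjacent c j≡1+i) (hasRank-1 r≤1 rank)
    where
    r≤1 : r ℕ.≤ 1
    r≤1 = approxMedianRank-2 {α} α<½ (subst (λ s → ApproxMedianRank α (suc s) r)
      (adjacent-∸ j≡1+i) median)

  module _ {x y} (y≰x : ¬ (y ≤ x)) where

    -- At the wrong index the entry is `y`, and being below both entries it would satisfy `y ≤ x`.
    entry-minimum : ∀ d b → All (entry x y d b ≤_) (entry x y d 0F ∷ entry x y d 1F ∷ []) →
                    d ≡ b
    entry-minimum 0F 0F _             = refl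
    entry-minimum 0F 1F (y≤x ∷ _)     = ⊥-elim (y≰x y≤x)
    entry-minimum 1F 0F (_ ∷ y≤x ∷ _) = ⊥-elim (y≰x y≤x)
    entry-minimum 1F 1F _             = refl

    blocks-minimum : ∀ {n} (w : Fin ⌊ n /2⌋ → Fin 2) t b →
      let c = blocks x y {n} w in
      All (lookup c (pos t b) ≤_) (lookup c (pos t 0F) ∷ lookup c (pos t 1F) ∷ []) →
      w t ≡ b
    blocks-minimum w t b
      rewrite lookup-blocks x y w t b | lookup-blocks x y w t 0F | lookup-blocks x y w t 1F
      = entry-minimum (w t) b

    -- The right-hand side mentions `p` alone, so a query answer determines the order of its block.
    parity-median : ∀ {α n} (w : Fin ⌊ n /2⌋ → Fin 2) t {p} → α <ᵣ fromℚ ½ →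
      IsApproxMedian O α (blocks x y {n} w) (pos t 0F) (pos t 1F) p → w t ≡ parity p
    parity-median {α} w t {p} α<½ median@(l , u , _) =
      from-pos (pos-surjective t l u)
        (approxMedian-adjacent {α} {c = c} {p = p} α<½ (pos-adjacent t) median)
      where
      c = blocks x y w
      from-pos : ∀ {p} → ∃[ b ] p ≡ pos t b →
        All (lookup c p ≤_) (lookup c (pos t 0F) ∷ lookup c (pos t 1F) ∷ []) →
        w t ≡ parity p
      from-pos (b , refl) minimum = trans (blocks-minimum w t b minimum) (sym (parity-pos t b))

    module _ {α n} (α<½ : α <ᵣ fromℚ ½) (D : ApproxRangeMedian O α n) where
      open ApproxRangeMedian D

      sequence : Fin (2 ^ ⌊ n /2⌋) → Vec Carrier n
      sequence i = blocks x y (finToFun {2} {⌊ n /2⌋} i)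

      -- The query algorithm sees only the encoding, so equal encodings give equal answers on every
      -- block, and these answers determine all the digits of the index.
      encode-injective : Injective _≡_ _≡_ (encode ∘ sequence)
      encode-injective {i} {j} eq = finToFun-injective {⌊ n /2⌋} λ t → trans (answer i t)
        (trans (cong (λ bs → parity (query bs (pos t 0F) (pos t 1F))) eq) (sym (answer j t)))
        where
        answer : ∀ i t → finToFun {2} {⌊ n /2⌋} i t ≡
                 parity (query (encode (sequence i)) (pos t 0F) (pos t 1F))
        answer i t = parity-median {α} (finToFun i) t α<½ (correct (sequence i) _ _
          (ℕ.≤-trans (ℕ.n≤1+n _) (ℕ.≤-reflexive (sym (pos-adjacent t)))))

      quarter-space : 2 ℕ.≤ n → SpaceAtLeast O D (¼ ℚ.* fromℕ n)
      quarter-space 2≤n =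
        let i , long = injective⇒long ⌊ n /2⌋ (encode ∘ sequence) encode-injective
        in sequence i , ¼*fromℕ≤ {n} {length (encode (sequence i))}
             (ℕ.≤-trans (n≤⌊n/2⌋*4 n 2≤n) (ℕ.*-monoˡ-≤ 4 long))

theorem11 : ∀ (a ℓ₁ ℓ₂ : Level) →
    ∃[ κ ] 0ℚ ℚ.< κ × ∃[ n₀ ]
    ((α : ℝ) → fromℚ 0ℚ <ᵣ α → α <ᵣ fromℚ ½ →
    (O : TotalOrder a ℓ₁ ℓ₂) (x y : TotalOrder.Carrier O) → ¬ (TotalOrder._≈_ O x y) →
    (n : ℕ) → n₀ ℕ.≤ n →
    (D : ApproxRangeMedian O α n) →
    SpaceAtLeast O D (κ ℚ.* fromℕ n))
theorem11 a ℓ₁ ℓ₂ = ¼ , ℚ.positive⁻¹ ¼ , 2 , λ α _ α<½ O x y x≉y n 2≤n D →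
  let open TotalOrder O using (total; antisym) in
  -- Totality decides which of the two distinct values is the smaller and takes the role of `x` in
  -- the blocks; antisymmetry makes the comparison strict.
  case total x y of λ where
    (inj₁ x≤y) → quarter-space O (λ y≤x → x≉y (antisym x≤y y≤x)) α<½ D 2≤n
    (inj₂ y≤x) → quarter-space O (λ x≤y → x≉y (antisym x≤y y≤x)) α<½ D 2≤n
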